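{- For every nonnegative integer $n$, $$pod(n)=\sum_{j=0}^{\infty}(-1)^j\,pod(j)\,\overline{p}_o(n-j).$$
   Context: $pod(n)$ denotes the number of partitions of $n$ in which odd parts are distinct and even parts may be repeated, with $pod(0)=1$. An overpartition of $n$ is a non-increasing sequence of positive integers with sum $n$ in which the first occurrence of each number may be overlined; $\overline{p}_o(n)$ is the number of overpartitions of $n$ into odd parts, with $\overline{p}_o(0)=1$ and $\overline{p}_o(m)=0$ for $m<0$. -}

module Defs where

open import Data.Bool using (Bool; true; false)
open import Data.Bool.Properties using () renaming (_≟_ to _≟ᵇ_)
open import Data.Integer as ℤ using (ℤ; +_; -[1+_])
open import Data.Integer.Properties using (+-0-monoid)
open import Data.Fin using (toℕ)
open import Data.List using (List; []; _∷_; map; filter; length; upTo;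
  cartesianProduct; cartesianProductWith)
open import Data.List.Membership.Propositional using (_∈_)
open import Data.List.Membership.Propositional.Properties
  using (∈-upTo⁺; ∈-filter⁺; ∈-filter⁻; ∈-cartesianProduct⁺; ∈-cartesianProductWith⁺;
         ∈-cartesianProductWith⁻)
open import Data.Nat.ListAction using (sum)
open import Data.List.Properties using (∷-injective; length-map)
open import Data.List.Relation.Unary.All as All using (All; []; _∷_; all?)
import Data.List.Relation.Unary.All.Properties as Allₚ
open import Data.List.Relation.Unary.AllPairs using (AllPairs; []; _∷_; allPairs?)
open import Data.List.Relation.Unary.Any using (here; there)
open import Data.List.Relation.Unary.Linked using (Linked; linked?)
open import Data.List.Relation.Unary.Unique.Propositional using (Unique)
import Data.List.Relation.Unary.Unique.Propositional.Properties as Uniqueₚ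
open import Data.Nat
open import Data.Nat.Divisibility using (_∣_; _∣?_)
open import Data.Nat.Properties hiding (+-0-monoid)
open import Data.List.Relation.Unary.Unique.DecPropositional _≟_ using (unique?)
open import Algebra.Properties.Monoid.Sum +-0-monoid using (sum-syntax)
open import Data.Product using (∃; _×_; _,_; proj₁; proj₂)
open import Function using (_⇔_; mk⇔)
open import Level using (Level)
open import Relation.Binary.PropositionalEquality using (_≡_; refl; sym; subst)
open import Relation.Nullary using (¬_; ¬?)
open import Relation.Nullary.Decidable using (_×-dec_; _→-dec_)
open import Relation.Unary using (Decidable)

private
  variable
    a : Level
    A : Set a

Odd : ℕ → Set
Odd m = ¬ (2 ∣ m)

odd? : Decidable Odd
odd? m = ¬? (2 ∣? m)

IsPartition : ℕ → List ℕ → Set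
IsPartition n λs = Linked _≥_ λs × All (0 <_) λs × sum λs ≡ n

IsPodPartition : ℕ → List ℕ → Set
IsPodPartition n λs = IsPartition n λs × Unique (filter odd? λs)

-- A part of an overpartition is its size together with a flag saying
-- whether it is overlined.
OverPart : Set
OverPart = ℕ × Bool

size : OverPart → ℕ
size = proj₁

overlined : OverPart → Bool
overlined = proj₂

-- The AllPairs condition says that a part preceded by a part of the same size
-- (so not the first occurrence of that size) is not overlined.
IsOverpartition : ℕ → List OverPart → Set
IsOverpartition n λs =
  IsPartition n (map size λs) ×
  AllPairs (λ p q → size p ≡ size q → overlined q ≡ false) λs

IsOddOverpartition : ℕ → List OverPart → Set
IsOddOverpartition n λs = IsOverpartition n λs × All Odd (map size λs)

isPartition? : ∀ n → Decidable (IsPartition n)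
isPartition? n λs = linked? _≥?_ λs ×-dec all? (0 <?_) λs ×-dec sum λs ≟ n

isPodPartition? : ∀ n → Decidable (IsPodPartition n)
isPodPartition? n λs = isPartition? n λs ×-dec unique? (filter odd? λs)

isOverpartition? : ∀ n → Decidable (IsOverpartition n)
isOverpartition? n λs =
  isPartition? n (map size λs) ×-dec
  allPairs? (λ p q → (size p ≟ size q) →-dec (overlined q ≟ᵇ false)) λs

isOddOverpartition? : ∀ n → Decidable (IsOddOverpartition n)
isOddOverpartition? n λs = isOverpartition? n λs ×-dec all? odd? (map size λs)

-- All lists of length at most k with entries in xs.
listsUpTo : ℕ → List A → List (List A)
listsUpTo zero    xs = [] ∷ []
listsUpTo (suc k) xs = [] ∷ cartesianProductWith _∷_ xs (listsUpTo k xs)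

-- A partition of n has at most n parts, each at most n, so filtering these
-- candidate lists loses nothing; see ∈-podPartitions and ∈-oddOverpartitions.
podPartitions : ℕ → List (List ℕ)
podPartitions n = filter (isPodPartition? n) (listsUpTo n (upTo (suc n)))

overParts : ℕ → List OverPart
overParts n = cartesianProduct (upTo (suc n)) (true ∷ false ∷ [])

oddOverpartitions : ℕ → List (List OverPart)
oddOverpartitions n = filter (isOddOverpartition? n) (listsUpTo n (overParts n))

pod : ℕ → ℕ
pod n = length (podPartitions n)

p̄ₒ : ℤ → ℕ
p̄ₒ (+ n)    = length (oddOverpartitions n)
p̄ₒ -[1+ _ ] = 0

-- The infinite series f 0 + f 1 + f 2 + ⋯ of integers converges to s. Since ℤ is
-- discrete, this means that the partial sums are eventually equal to s.
HasSum : (ℕ → ℤ) → ℤ → Set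
HasSum f s = ∃ λ N → ∀ m → m ≥ N → (∑[ j < m ] f (toℕ j)) ≡ s

-- The enumerations list every object being counted exactly once.

private
  listsUpTo-unique : ∀ k {xs : List A} → Unique xs → Unique (listsUpTo k xs)
  listsUpTo-unique zero    u = [] ∷ []
  listsUpTo-unique (suc k) {xs} u =
    All.tabulate (λ y∈ eq → []∉ (subst (_∈ _) (sym eq) y∈))
    ∷ Uniqueₚ.cartesianProductWith⁺ _∷_ ∷-injective u (listsUpTo-unique k u)
    where
    []∉ : ¬ ([] ∈ cartesianProductWith _∷_ xs (listsUpTo k xs))
    []∉ p with ∈-cartesianProductWith⁻ _∷_ xs (listsUpTo k xs) p
    ... | _ , _ , _ , _ , ()

  ∈-listsUpTo : ∀ k {xs ys : List A} → length ys ≤ k → All (_∈ xs) ys → ys ∈ listsUpTo k xs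
  ∈-listsUpTo zero    {ys = []} _ _ = here refl
  ∈-listsUpTo (suc k) {ys = []} _ _ = here refl
  ∈-listsUpTo (suc k) {ys = _ ∷ _} (s≤s l) (p ∷ ps) =
    there (∈-cartesianProductWith⁺ _∷_ p (∈-listsUpTo k l ps))

  length≤sum : ∀ {ys} → All (0 <_) ys → length ys ≤ sum ys
  length≤sum []       = z≤n
  length≤sum (p ∷ ps) = +-mono-≤ p (length≤sum ps)

  parts≤sum : ∀ ys → All (_≤ sum ys) ys
  parts≤sum []       = []
  parts≤sum (y ∷ ys) =
    m≤m+n y (sum ys) ∷ All.map (λ le → ≤-trans le (m≤n+m (sum ys) y)) (parts≤sum ys)

  ∈-bools : ∀ b → b ∈ true ∷ false ∷ []
  ∈-bools true  = here refl
  ∈-bools false = there (here refl)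

podPartitions-unique : ∀ n → Unique (podPartitions n)
podPartitions-unique n =
  Uniqueₚ.filter⁺ (isPodPartition? n) (listsUpTo-unique n (Uniqueₚ.upTo⁺ (suc n)))

∈-podPartitions : ∀ n λs → λs ∈ podPartitions n ⇔ IsPodPartition n λs
∈-podPartitions n λs = mk⇔
  (λ p → proj₂ (∈-filter⁻ (isPodPartition? n) {xs = listsUpTo n (upTo (suc n))} p))
  λ { q@((_ , pos , refl) , _) → ∈-filter⁺ (isPodPartition? n)
        (∈-listsUpTo n (length≤sum pos)
          (All.map (λ le → ∈-upTo⁺ (s≤s le)) (parts≤sum λs))) q }

oddOverpartitions-unique : ∀ n → Unique (oddOverpartitions n)
oddOverpartitions-unique n =
  Uniqueₚ.filter⁺ (isOddOverpartition? n)
    (listsUpTo-unique n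
      (Uniqueₚ.cartesianProduct⁺ (Uniqueₚ.upTo⁺ (suc n)) (((λ ()) ∷ []) ∷ [] ∷ [])))

∈-oddOverpartitions : ∀ n λs → λs ∈ oddOverpartitions n ⇔ IsOddOverpartition n λs
∈-oddOverpartitions n λs = mk⇔
  (λ p → proj₂ (∈-filter⁻ (isOddOverpartition? n) {xs = listsUpTo n (overParts n)} p))
  λ { q@(((_ , pos , refl) , _) , _) → ∈-filter⁺ (isOddOverpartition? n)
        (∈-listsUpTo n (subst (_≤ n) (length-map size λs) (length≤sum pos))
          (All.map (λ {p} le → ∈-cartesianProduct⁺ (∈-upTo⁺ (s≤s le)) (∈-bools (overlined p)))
            (Allₚ.map⁻ (parts≤sum (map size λs))))) q }

{-# OPTIONS --safe #-}
module Submission where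

-- With odd parts distinct, pod has generating function ∏ (1 + q^(2i-1)) / (1 - q^(2i)); replacing q
-- by -q gives the series of (-1)^j pod(j), while p̄ₒ has ∏ (1 + q^(2i-1)) / (1 - q^(2i-1)), and the
-- product of the last two is the first. To stay with finite products, the parts are bounded by k
-- and the identity is proved by induction on k: removing one copy of the largest allowed part
-- turns each factor of a product into a recurrence for the coefficients.

open import Defs
open import Data.Bool using (true; false) renaming (_≟_ to _≟ᵇ_)
open import Data.Empty using (⊥; ⊥-elim)
open import Data.Fin using (toℕ)
open import Data.Integer using (ℤ; -[1+_]; 0ℤ; 1ℤ; +_; _*_; _-_; _^_; -1ℤ) renaming (_+_ to _⊕_)
open import Data.Integer.Properties as ℤₚ using (+-0-monoid; [1+m]⊖[1+n]≡m⊖n)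
open import Data.Integer.Tactic.RingSolver using (solve-∀)
open import Data.List using (List; []; _∷_; _++_; map; filter; length)
open import Data.List.Membership.Propositional using (_∈_)
open import Data.List.Membership.Propositional.Properties
  using (∈-filter⁺; ∈-filter⁻; ∈-map⁺; ∈-map⁻; ∈-++⁺ˡ; ∈-++⁺ʳ; ∈-++⁻)
open import Data.List.Properties using (∷-injectiveʳ; filter-all; filter-accept; filter-reject;
  length-++; length-map; map-id)
open import Data.List.Relation.Binary.Permutation.Propositional.Properties using (↭-length)
open import Data.List.Membership.Propositional.Properties.WithK using (unique∧set⇒bag)
open import Data.List.Relation.Binary.BagAndSetEquality using (∼bag⇒↭)
open import Data.List.Relation.Unary.All as All using (All; []; _∷_; all?)
import Data.List.Relation.Unary.All.Properties as Allₚ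
open import Data.List.Relation.Unary.AllPairs as AllPairs using (AllPairs; []; _∷_)
import Data.List.Relation.Unary.AllPairs.Properties as AllPairsₚ
open import Data.List.Relation.Unary.Any using (here)
open import Data.List.Relation.Unary.Linked.Properties using (AllPairs⇒Linked; Linked⇒AllPairs)
open import Data.List.Relation.Unary.Unique.Propositional using (Unique)
import Data.List.Relation.Unary.Unique.Propositional.Properties as Uniqueₚ
open import Data.Nat using (ℕ; zero; suc; _+_; _≤_; _<_; _≥_; z≤n; s≤s; _≤?_; _≟_)
open import Data.Nat.Divisibility using (_∣_; _∣0; ∣-refl; ∣m∣n⇒∣m+n; ∣m+n∣m⇒∣n; ∣1⇒≡1)
open import Data.Nat.ListAction using (sum)
open import Data.Nat.Properties
  using (≤-refl; ≤-trans; ≤-reflexive; ≤-pred; m≤n⇒m≤1+n; m≤m+n; m≤n+m; m≤n⇒m<n∨m≡n;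
         <⇒≱; 1+n≰n; suc-injective)
open import Algebra.Properties.Monoid.Sum +-0-monoid using (sum-syntax)
open import Data.Product using (∃; _×_; _,_; proj₁; proj₂)
open import Data.Product.Properties using (≡-dec)
open import Data.Sum using (_⊎_; inj₁; inj₂; [_,_])
open import Function using (_∘_; id; _⇔_; mk⇔; Equivalence)
open import Function.Properties.Equivalence using () renaming (trans to ⇔-trans; sym to ⇔-sym)
open import Relation.Binary.PropositionalEquality hiding ([_])
open import Relation.Nullary using (¬_; yes; no; contradiction)
open import Relation.Nullary.Decidable using (_⊎-dec_)
open import Relation.Unary using (Decidable)

open Equivalence using (to; from)

-- Duplicate-free lists and shifted sequences

length-cong : ∀ {A : Set} {xs ys : List A} → Unique xs → Unique ys →
              (∀ z → z ∈ xs ⇔ z ∈ ys) → length xs ≡ length ys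
length-cong uxs uys xs⇔ys = ↭-length (∼bag⇒↭ (unique∧set⇒bag uxs uys (xs⇔ys _)))

-- With d = 0 and f the coefficients of a power series, this is multiplication by q^k.
delay : ∀ {A : Set} → A → ℕ → (ℕ → A) → ℕ → A
delay d zero    f n       = f n
delay d (suc k) f zero    = d
delay d (suc k) f (suc n) = delay d k f n

delay-natural : ∀ {A B : Set} (h : A → B) {d} k f n → h (delay d k f n) ≡ delay (h d) k (h ∘ f) n
delay-natural h zero    f n       = refl
delay-natural h (suc k) f zero    = refl
delay-natural h (suc k) f (suc n) = delay-natural h k f n

delay-cong : ∀ {A : Set} {d : A} k {f g} n → (∀ m → m ≤ n → f m ≡ g m) →
             delay d k f n ≡ delay d k g n
delay-cong zero    n       f≡g = f≡g n ≤-refl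
delay-cong (suc k) zero    f≡g = refl
delay-cong (suc k) (suc n) f≡g = delay-cong k n (λ m m≤n → f≡g m (m≤n⇒m≤1+n m≤n))

delay⁺-unique : ∀ {A : Set} k {f : ℕ → List A} → (∀ n → Unique (f n)) → ∀ n → Unique (delay [] k f n)
delay⁺-unique zero    u n       = u n
delay⁺-unique (suc k) u zero    = []
delay⁺-unique (suc k) u (suc n) = delay⁺-unique k u n

∈-delay : ∀ {A : Set} {x : A} k {f} n → x ∈ delay [] k f n ⇔ ∃ λ m → k + m ≡ n × x ∈ f m
∈-delay zero    n       = mk⇔ (λ p → n , refl , p) (λ { (_ , refl , p) → p })
∈-delay (suc k) zero    = mk⇔ (λ ()) (λ ())
∈-delay (suc k) (suc n) = mk⇔
  (λ p → let m , eq , q = to (∈-delay k n) p in m , cong suc eq , q)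
  (λ { (m , eq , q) → from (∈-delay k n) (m , suc-injective eq , q) })

-- Counting lists under a pairwise relation, by allowed parts

module Counting {A : Set} (R : A → A → Set) (Q : A → Set) (w : A → ℕ)
  (enum : ℕ → List (List A)) (enum-unique : ∀ n → Unique (enum n))
  (∈-enum : ∀ n λs → λs ∈ enum n ⇔ (AllPairs R λs × All Q λs × sum (map w λs) ≡ n))
  where

  restrict : ∀ {S : A → Set} → Decidable S → ℕ → List (List A)
  restrict S? n = filter (all? S?) (enum n)

  count : ∀ {S : A → Set} → Decidable S → ℕ → ℕ
  count S? n = length (restrict S? n)

  restrict-unique : ∀ {S} (S? : Decidable S) n → Unique (restrict S? n)
  restrict-unique S? n = Uniqueₚ.filter⁺ (all? S?) (enum-unique n)

  ∈-restrict : ∀ {S} (S? : Decidable S) n λs →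
    λs ∈ restrict S? n ⇔ (All S λs × AllPairs R λs × All Q λs × sum (map w λs) ≡ n)
  ∈-restrict S? n λs = mk⇔
    (λ p → let q , s = ∈-filter⁻ (all? S?) p in s , to (∈-enum n λs) q)
    (λ { (s , q) → ∈-filter⁺ (all? S?) (from (∈-enum n λs) q) s })

  -- Agreement is asked only at parts satisfying `Q`; hence raising the bound to an even number
  -- changes nothing when all parts are odd.
  count-cong : ∀ {S T} (S? : Decidable S) (T? : Decidable T) →
    (∀ y → Q y → S y ⇔ T y) → ∀ n → count S? n ≡ count T? n
  count-cong S? T? S⇔T n =
    length-cong (restrict-unique S? n) (restrict-unique T? n) λ λs → mk⇔
      (λ p → let s , r , q , e = to (∈-restrict S? n λs) p in
        from (∈-restrict T? n λs) (All.zipWith (λ (s , q) → to (S⇔T _ q) s) (s , q) , r , q , e))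
      (λ p → let t , r , q , e = to (∈-restrict T? n λs) p in
        from (∈-restrict S? n λs) (All.zipWith (λ (t , q) → from (S⇔T _ q) t) (t , q) , r , q , e))

  -- With every part excluded only the empty list is counted, so the generating function is 1: the
  -- base of the induction.
  module _ {S : A → Set} (S? : Decidable S) (empty : ∀ y → Q y → ¬ S y) where

    count-empty-zero : count S? 0 ≡ 1
    count-empty-zero = length-cong (restrict-unique S? 0) ([] ∷ []) λ λs → mk⇔
      (only λs)
      λ { (here refl) → from (∈-restrict S? 0 []) ([] , [] , [] , refl) }
      where
      only : ∀ λs → λs ∈ restrict S? 0 → λs ∈ [] ∷ []
      only []       _ = here refl
      only (y ∷ λs) p with to (∈-restrict S? 0 (y ∷ λs)) p
      ... | s ∷ _ , _ , q ∷ _ , _ = ⊥-elim (empty y q s)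

    count-empty-suc : ∀ n → count S? (suc n) ≡ 0
    count-empty-suc n = length-cong (restrict-unique S? (suc n)) [] λ λs → mk⇔ (none λs) (λ ())
      where
      none : ∀ λs → λs ∈ restrict S? (suc n) → λs ∈ []
      none λs p with to (∈-restrict S? (suc n) λs) p
      none [] p | _ , _ , _ , ()
      none (y ∷ _) p | s ∷ _ , _ , q ∷ _ , _ = ⊥-elim (empty y q s)

  -- If x must precede all parts in S, a list with parts in S ∪ {x} either avoids x
  -- or starts with x, the rest then being made of the parts that may follow x.
  count-peel : ∀ {S S′ T} (S? : Decidable S) (S′? : Decidable S′) (T? : Decidable T) x → Q x →
    (∀ y → S′ y ⇔ (y ≡ x ⊎ S y)) → (∀ y → T y ⇔ (S′ y × R x y)) →
    ¬ S x → (∀ y → S y → ¬ R y x) →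
    ∀ n → count S′? n ≡ count S? n + delay 0 (w x) (count T?) n
  count-peel {S} {S′} {T} S? S′? T? x Qx S′⇔ T⇔ x∉S ¬Rx n =
    trans (length-cong (restrict-unique S′? n) unique λ λs → mk⇔ (split λs) (merge λs))
      (trans (length-++ (restrict S? n))
        (cong (_+_ (length (restrict S? n)))
          (trans (delay-natural length (w x) headed n)
            (delay-cong (w x) n (λ m _ → length-map (x ∷_) (restrict T? m))))))
    where
    headed : ℕ → List (List A)
    headed m = map (x ∷_) (restrict T? m)

    ∈-headed : ∀ {m λs} → λs ∈ headed m → ∃ λ μ → μ ∈ restrict T? m × λs ≡ x ∷ μ
    ∈-headed = ∈-map⁻ (x ∷_)

    -- The two pieces are disjoint because a list in the second one starts with `x`, which is not in
    -- `S`.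
    unique : Unique (restrict S? n ++ delay [] (w x) headed n)
    unique = Uniqueₚ.++⁺ (restrict-unique S? n)
      (delay⁺-unique (w x) (λ m → Uniqueₚ.map⁺ ∷-injectiveʳ (restrict-unique T? m)) n)
      λ { {λs} (p , q) → disjoint (to (∈-restrict S? n λs) p) (to (∈-delay (w x) n) q) }
      where
      disjoint : ∀ {λs} → All S λs × AllPairs R λs × All Q λs × sum (map w λs) ≡ n →
                 (∃ λ m → w x + m ≡ n × λs ∈ headed m) → ⊥
      disjoint (s , _) (m , _ , p) with ∈-headed p
      disjoint (s ∷ _ , _) (m , _ , p) | _ , _ , refl = x∉S s

    -- Once the head lies in `S`, `¬Rx` forbids any later `x`, so the whole list stays in `S`.
    drop-x : ∀ {y zs} → S y → All S′ zs → All (R y) zs → All S zs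
    drop-x Sy []       []       = []
    drop-x Sy (s ∷ ss) (r ∷ rs) with to (S′⇔ _) s
    ... | inj₁ refl = ⊥-elim (¬Rx _ Sy r)
    ... | inj₂ Sz   = Sz ∷ drop-x Sy ss rs

    split : ∀ λs → λs ∈ restrict S′? n → λs ∈ restrict S? n ++ delay [] (w x) headed n
    split λs p with to (∈-restrict S′? n λs) p
    split [] p | _ , rest = ∈-++⁺ˡ (from (∈-restrict S? n []) ([] , rest))
    split (y ∷ μ) p | s ∷ ss , r ∷ rs , q ∷ qs , e with to (S′⇔ y) s
    ... | inj₂ Sy   = ∈-++⁺ˡ
      (from (∈-restrict S? n (y ∷ μ)) (Sy ∷ drop-x Sy ss r , r ∷ rs , q ∷ qs , e))
    ... | inj₁ refl = ∈-++⁺ʳ (restrict S? n) (from (∈-delay (w x) n)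
      (_ , e , ∈-map⁺ (x ∷_) (from (∈-restrict T? _ μ)
        (All.zipWith (from (T⇔ _)) (ss , r) , rs , qs , refl))))

    merge : ∀ λs → λs ∈ restrict S? n ++ delay [] (w x) headed n → λs ∈ restrict S′? n
    merge λs p with ∈-++⁻ (restrict S? n) p
    ... | inj₁ q = let s , rest = to (∈-restrict S? n λs) q in
      from (∈-restrict S′? n λs) (All.map (λ s → from (S′⇔ _) (inj₂ s)) s , rest)
    ... | inj₂ q with to (∈-delay (w x) n) q
    ... | m , refl , q′ with ∈-headed q′
    ... | μ , μ∈ , refl with to (∈-restrict T? m μ) μ∈
    ... | t , r , q″ , refl = from (∈-restrict S′? n (x ∷ μ))
      ( from (S′⇔ x) (inj₁ refl) ∷ All.map (proj₁ ∘ to (T⇔ _)) t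
      , All.map (proj₂ ∘ to (T⇔ _)) t ∷ r , Qx ∷ q″ , refl)

-- Parity and bounds

-- Parity and sign are decided together: replacing q by -q negates q^k exactly when `k` is odd.
parity : ∀ k → (2 ∣ k × -1ℤ ^ k ≡ 1ℤ) ⊎ (Odd k × -1ℤ ^ k ≡ -1ℤ)
parity 0 = inj₁ (2 ∣0 , refl)
parity 1 = inj₂ ((λ p → contradiction (∣1⇒≡1 p) λ ()) , refl)
parity (suc (suc k)) with parity k
... | inj₁ (p , e) = inj₁ (∣m∣n⇒∣m+n ∣-refl p , cong (λ i → -1ℤ * (-1ℤ * i)) e)
... | inj₂ (p , e) = inj₂ ((λ q → p (∣m+n∣m⇒∣n q ∣-refl)) , cong (λ i → -1ℤ * (-1ℤ * i)) e)

≤suc⇔ : ∀ {k y} → y ≤ suc k ⇔ (y ≡ suc k ⊎ y ≤ k)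
≤suc⇔ = mk⇔
  (λ p → [ (λ q → inj₂ (≤-pred q)) , inj₁ ] (m≤n⇒m<n∨m≡n p))
  [ ≤-reflexive , m≤n⇒m≤1+n ]

≤∧≢suc⇒≤ : ∀ {k y} → y ≤ suc k → suc k ≢ y → y ≤ k
≤∧≢suc⇒≤ p y≢ = [ (λ e → ⊥-elim (y≢ (sym e))) , id ] (to ≤suc⇔ p)

-- The two families as pairwise-related lists

PodOrder : ℕ → ℕ → Set
PodOrder x y = x ≥ y × (Odd x → x ≢ y)

filter-odd-unique⇔ : ∀ λs → Unique (filter odd? λs) ⇔ AllPairs (λ x y → Odd x → x ≢ y) λs
filter-odd-unique⇔ λs = mk⇔ (fwd λs) (bwd λs)
  where
  fwd : ∀ λs → Unique (filter odd? λs) → AllPairs (λ x y → Odd x → x ≢ y) λs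
  fwd []       u = []
  fwd (x ∷ λs) u with odd? x
  ... | no ¬o = All.tabulate (λ _ o → ⊥-elim (¬o o)) ∷ fwd λs (subst Unique (filter-reject odd? ¬o) u)
  ... | yes o with subst Unique (filter-accept odd? o) u
  ... | n ∷ u′ =
    -- A later part equal to `x` is odd too, so it survives the filter and contradicts uniqueness
    -- there.
    All.tabulate (λ y∈ _ x≡y → All.lookup n (∈-filter⁺ odd? y∈ (subst Odd x≡y o)) x≡y) ∷ fwd λs u′

  bwd : ∀ λs → AllPairs (λ x y → Odd x → x ≢ y) λs → Unique (filter odd? λs)
  bwd []       []      = []
  bwd (x ∷ λs) (n ∷ u) with odd? x
  ... | no ¬o = subst Unique (sym (filter-reject odd? ¬o)) (bwd λs u)
  ... | yes o = subst Unique (sym (filter-accept odd? o))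
    (All.tabulate (λ y∈ → All.lookup n (proj₁ (∈-filter⁻ odd? y∈)) o) ∷ bwd λs u)

≥-trans : ∀ {i j k : ℕ} → i ≥ j → j ≥ k → i ≥ k
≥-trans p q = ≤-trans q p

-- Transitivity of `_≥_` turns comparison of neighbours into comparison of all pairs, which merges
-- with distinctness into one relation. The sum is written with `map id` to fit the weight in
-- `Counting`.
∈-podPartitions-chain : ∀ n λs →
  λs ∈ podPartitions n ⇔ (AllPairs PodOrder λs × All (0 <_) λs × sum (map id λs) ≡ n)
∈-podPartitions-chain n λs = ⇔-trans (∈-podPartitions n λs) (mk⇔
  (λ { ((l , pos , e) , u) →
    AllPairs.zip (Linked⇒AllPairs ≥-trans l , to (filter-odd-unique⇔ λs) u) , pos ,
    trans (cong sum (map-id λs)) e })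
  (λ { (r , pos , e) → let l , u = AllPairs.unzip r in
    (AllPairs⇒Linked l , pos , trans (cong sum (sym (map-id λs))) e) , from (filter-odd-unique⇔ λs) u }))

OverOrder : OverPart → OverPart → Set
OverOrder p q = size p ≥ size q × (size p ≡ size q → overlined q ≡ false)

∈-oddOverpartitions-chain : ∀ n λs →
  λs ∈ oddOverpartitions n ⇔
  (AllPairs OverOrder λs × All (λ p → 0 < size p × Odd (size p)) λs × sum (map size λs) ≡ n)
∈-oddOverpartitions-chain n λs = ⇔-trans (∈-oddOverpartitions n λs) (mk⇔
  (λ { (((l , pos , e) , u) , o) →
    AllPairs.zip (AllPairsₚ.map⁻ (Linked⇒AllPairs ≥-trans l) , u) ,
    All.zip (Allₚ.map⁻ pos , Allₚ.map⁻ o) , e })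
  (λ { (r , q , e) → let l , u = AllPairs.unzip r ; pos , o = All.unzip q in
    ((AllPairs⇒Linked (AllPairsₚ.map⁺ l) , Allₚ.map⁺ pos , e) , u) , Allₚ.map⁺ o }))

module Pod = Counting PodOrder (0 <_) id podPartitions podPartitions-unique ∈-podPartitions-chain
module Over = Counting OverOrder (λ p → 0 < size p × Odd (size p)) size
  oddOverpartitions oddOverpartitions-unique ∈-oddOverpartitions-chain

-- Recurrences for pod with bounded parts

pod≤ : ℕ → ℕ → ℕ
pod≤ k = Pod.count (_≤? k)

parts≤sum : ∀ {A : Set} (w : A → ℕ) λs → All (λ y → w y ≤ sum (map w λs)) λs
parts≤sum w []       = []
parts≤sum w (y ∷ λs) =
  m≤m+n (w y) _ ∷ All.map (λ p → ≤-trans p (m≤n+m _ (w y))) (parts≤sum w λs)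

-- No part exceeds the total, so the filter by the bound discards nothing.
pod≤-all : ∀ {k n} → n ≤ k → pod≤ k n ≡ pod n
pod≤-all {k} {n} n≤k = cong length (filter-all (all? (_≤? k)) (All.tabulate λ {λs} p →
  let _ , _ , e = to (∈-podPartitions-chain n λs) p in
  All.map (λ q → ≤-trans q (≤-trans (≤-reflexive e) n≤k)) (parts≤sum id λs)))

-- An even part may follow itself, so the bound stays at `suc k` after one copy is removed: the
-- factor 1/(1 - q^(k+1)).
pod≤-even : ∀ k → 2 ∣ suc k → ∀ n → pod≤ (suc k) n ≡ pod≤ k n + delay 0 (suc k) (pod≤ (suc k)) n
pod≤-even k even = Pod.count-peel (_≤? k) (_≤? suc k) (_≤? suc k) (suc k) (s≤s z≤n)
  (λ _ → ≤suc⇔)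
  (λ y → mk⇔ (λ p → p , p , λ odd → ⊥-elim (odd even)) proj₁)
  1+n≰n (λ y p (q , _) → <⇒≱ q p)

-- An odd part occurs at most once, so the bound drops to `k` after its removal: the factor 1 +
-- q^(k+1).
pod≤-odd : ∀ k → Odd (suc k) → ∀ n → pod≤ (suc k) n ≡ pod≤ k n + delay 0 (suc k) (pod≤ k) n
pod≤-odd k odd = Pod.count-peel (_≤? k) (_≤? suc k) (_≤? k) (suc k) (s≤s z≤n)
  (λ _ → ≤suc⇔)
  (λ y → mk⇔ (λ p → m≤n⇒m≤1+n p , m≤n⇒m≤1+n p , λ { _ refl → 1+n≰n p })
             (λ (p , _ , ≢y) → ≤∧≢suc⇒≤ p (≢y odd)))
  1+n≰n (λ y p (q , _) → <⇒≱ q p)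

-- Recurrences for odd overpartitions with bounded parts

size≤? : ∀ k → Decidable (λ (p : OverPart) → size p ≤ k)
size≤? k p = size p ≤? k

p̄ₒ≤ : ℕ → ℕ → ℕ
p̄ₒ≤ k = Over.count (size≤? k)

p̄ₒ≤-all : ∀ {k n} → n ≤ k → p̄ₒ≤ k n ≡ p̄ₒ (+ n)
p̄ₒ≤-all {k} {n} n≤k = cong length (filter-all (all? (size≤? k)) (All.tabulate λ {λs} p →
  let _ , _ , e = to (∈-oddOverpartitions-chain n λs) p in
  All.map (λ q → ≤-trans q (≤-trans (≤-reflexive e) n≤k)) (parts≤sum size λs)))

p̄ₒ≤-even : ∀ k → 2 ∣ suc k → ∀ n → p̄ₒ≤ (suc k) n ≡ p̄ₒ≤ k n
p̄ₒ≤-even k even = Over.count-cong (size≤? (suc k)) (size≤? k) λ y (_ , odd) →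
  mk⇔ (λ p → ≤∧≢suc⇒≤ p (λ e → odd (subst (2 ∣_) e even))) m≤n⇒m≤1+n

PlainSuc : ℕ → OverPart → Set
PlainSuc k p = p ≡ (suc k , false) ⊎ size p ≤ k

plainSuc? : ∀ k → Decidable (PlainSuc k)
plainSuc? k p = ≡-dec _≟_ _≟ᵇ_ p (suc k , false) ⊎-dec size≤? k p

PlainSuc⇒≤ : ∀ {k} p → PlainSuc k p → size p ≤ suc k
PlainSuc⇒≤ _ (inj₁ refl) = ≤-refl
PlainSuc⇒≤ _ (inj₂ p)    = m≤n⇒m≤1+n p

PlainSuc⇒plain : ∀ {k} p → PlainSuc k p → suc k ≡ size p → overlined p ≡ false
PlainSuc⇒plain _ (inj₁ refl) _    = refl
PlainSuc⇒plain _ (inj₂ p)    refl = ⊥-elim (1+n≰n p)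

-- Adding the plain part k + 1 first multiplies the generating function by 1/(1 - q^(k+1)),
-- adding its overlined copy, which can be used once, by 1 + q^(k+1).
p̄ₒ-plain : ℕ → ℕ → ℕ
p̄ₒ-plain k = Over.count (plainSuc? k)

-- A plain part may follow itself, so the same parts remain available after one copy is removed.
p̄ₒ-plain-odd : ∀ k → Odd (suc k) → ∀ n →
  p̄ₒ-plain k n ≡ p̄ₒ≤ k n + delay 0 (suc k) (p̄ₒ-plain k) n
p̄ₒ-plain-odd k odd = Over.count-peel (size≤? k) (plainSuc? k) (plainSuc? k) (suc k , false)
  (s≤s z≤n , odd)
  (λ _ → mk⇔ id id)
  (λ y → mk⇔ (λ p → p , PlainSuc⇒≤ y p , PlainSuc⇒plain y p) proj₁)
  1+n≰n (λ y p (q , _) → <⇒≱ q p)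

-- Only the first part of a given size can be overlined, so the overlined `suc k` heads its list,
-- and plain copies or smaller parts follow.
p̄ₒ≤-odd : ∀ k → Odd (suc k) → ∀ n →
  p̄ₒ≤ (suc k) n ≡ p̄ₒ-plain k n + delay 0 (suc k) (p̄ₒ-plain k) n
p̄ₒ≤-odd k odd = Over.count-peel (plainSuc? k) (size≤? (suc k)) (plainSuc? k) (suc k , true)
  (s≤s z≤n , odd)
  (λ y → mk⇔ (add y) (λ { (inj₁ refl) → ≤-refl ; (inj₂ p) → PlainSuc⇒≤ y p }))
  (λ y → mk⇔ (λ p → PlainSuc⇒≤ y p , PlainSuc⇒≤ y p , PlainSuc⇒plain y p) (follow y))
  (λ { (inj₁ ()) ; (inj₂ p) → 1+n≰n p })
  first
  where
  add : ∀ y → size y ≤ suc k → y ≡ (suc k , true) ⊎ PlainSuc k y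
  add (s , b) p with to ≤suc⇔ p
  add (s , true)  p | inj₁ refl = inj₁ refl
  add (s , false) p | inj₁ refl = inj₂ (inj₁ refl)
  add (s , b)     p | inj₂ q    = inj₂ (inj₂ q)

  follow : ∀ y → size y ≤ suc k × OverOrder (suc k , true) y → PlainSuc k y
  follow y (p , _ , ¬over) with add y p
  ... | inj₂ q = q
  ... | inj₁ refl with () ← ¬over refl

  first : ∀ y → PlainSuc k y → ¬ OverOrder y (suc k , true)
  first y (inj₁ refl) (_ , ¬over) with () ← ¬over refl
  first y (inj₂ p)    (q , _)     = <⇒≱ q p

pod≤0 : pod≤ 0 0 ≡ 1 × (∀ n → pod≤ 0 (suc n) ≡ 0)
pod≤0 = Pod.count-empty-zero (_≤? 0) (λ y → <⇒≱) , Pod.count-empty-suc (_≤? 0) (λ y → <⇒≱)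

p̄ₒ≤0 : p̄ₒ≤ 0 0 ≡ 1 × (∀ n → p̄ₒ≤ 0 (suc n) ≡ 0)
p̄ₒ≤0 = Over.count-empty-zero (size≤? 0) (λ y q → <⇒≱ (proj₁ q)) ,
       Over.count-empty-suc (size≤? 0) (λ y q → <⇒≱ (proj₁ q))

-- Cauchy products of integer sequences

Series : Set
Series = ℕ → ℤ

infixl 7 _⊛_

-- The Cauchy product of power series; splitting off `f 0` makes it structurally recursive in the
-- index.
_⊛_ : Series → Series → Series
(f ⊛ g) zero    = f 0 * g 0
(f ⊛ g) (suc n) = f 0 * g (suc n) ⊕ ((f ∘ suc) ⊛ g) n

-- Coefficient `n` of a product involves only coefficients up to `n`, which lets bounded counts
-- stand in for unbounded ones.
⊛-cong : ∀ {f f′ g g′} n → (∀ m → m ≤ n → f m ≡ f′ m) → (∀ m → m ≤ n → g m ≡ g′ m) →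
         (f ⊛ g) n ≡ (f′ ⊛ g′) n
⊛-cong zero    p q = cong₂ _*_ (p 0 z≤n) (q 0 z≤n)
⊛-cong (suc n) p q = cong₂ _⊕_ (cong₂ _*_ (p 0 z≤n) (q (suc n) ≤-refl))
  (⊛-cong n (λ m m≤n → p (suc m) (s≤s m≤n)) (λ m m≤n → q m (m≤n⇒m≤1+n m≤n)))

-- The scalar `c` carries the sign that a shifted term acquires under the substitution of -q.
⊛-linearˡ : ∀ c f g h n → ((λ m → f m ⊕ c * g m) ⊛ h) n ≡ (f ⊛ h) n ⊕ c * (g ⊛ h) n
⊛-linearˡ c f g h zero    = lemma c (f 0) (g 0) (h 0)
  where
  lemma : ∀ c a b x → (a ⊕ c * b) * x ≡ a * x ⊕ c * (b * x)
  lemma = solve-∀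
⊛-linearˡ c f g h (suc n) =
  trans (cong (_⊕_ ((f 0 ⊕ c * g 0) * h (suc n))) (⊛-linearˡ c (f ∘ suc) (g ∘ suc) h n))
        (lemma c (f 0) (g 0) (h (suc n)) _ _)
  where
  lemma : ∀ c a b x u v → (a ⊕ c * b) * x ⊕ (u ⊕ c * v) ≡ (a * x ⊕ u) ⊕ c * (b * x ⊕ v)
  lemma = solve-∀

⊛-distribˡ : ∀ f g h n → (f ⊛ (λ m → g m ⊕ h m)) n ≡ (f ⊛ g) n ⊕ (f ⊛ h) n
⊛-distribˡ f g h zero    = ℤₚ.*-distribˡ-+ (f 0) (g 0) (h 0)
⊛-distribˡ f g h (suc n) =
  trans (cong (_⊕_ (f 0 * (g (suc n) ⊕ h (suc n)))) (⊛-distribˡ (f ∘ suc) g h n))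
        (lemma (f 0) (g (suc n)) (h (suc n)) _ _)
  where
  lemma : ∀ a x y u v → a * (x ⊕ y) ⊕ (u ⊕ v) ≡ (a * x ⊕ u) ⊕ (a * y ⊕ v)
  lemma = solve-∀

⊛-zeroˡ : ∀ {f} g n → (∀ m → f m ≡ 0ℤ) → (f ⊛ g) n ≡ 0ℤ
⊛-zeroˡ g zero    f≡0 = cong (_* g 0) (f≡0 0)
⊛-zeroˡ g (suc n) f≡0 = cong₂ _⊕_ (cong (_* g (suc n)) (f≡0 0)) (⊛-zeroˡ g n (f≡0 ∘ suc))

⊛-identityˡ : ∀ {f} g n → f 0 ≡ 1ℤ → (∀ m → f (suc m) ≡ 0ℤ) → (f ⊛ g) n ≡ g n
⊛-identityˡ g zero    f0 fsuc = trans (cong (_* g 0) f0) (ℤₚ.*-identityˡ (g 0))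
⊛-identityˡ g (suc n) f0 fsuc =
  trans (cong₂ _⊕_ (trans (cong (_* g (suc n)) f0) (ℤₚ.*-identityˡ _)) (⊛-zeroˡ g n fsuc))
        (ℤₚ.+-identityʳ _)

⊛-delayˡ : ∀ k f g n → (delay 0ℤ k f ⊛ g) n ≡ delay 0ℤ k (f ⊛ g) n
⊛-delayˡ zero    f g n       = refl
⊛-delayˡ (suc k) f g zero    = refl
⊛-delayˡ (suc k) f g (suc n) = trans (ℤₚ.+-identityˡ _) (⊛-delayˡ k f g n)

⊛-delayʳ : ∀ k f g n → (f ⊛ delay 0ℤ k g) n ≡ delay 0ℤ k (f ⊛ g) n
⊛-delayʳ zero    f g n       = refl
⊛-delayʳ (suc k) f g zero    = ℤₚ.*-zeroʳ (f 0)
⊛-delayʳ (suc k) f g (suc n) = trans (shift f n) (⊛-delayʳ k f g n)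
  where
  -- The product recurses on its left factor, so a shift on the right needs its own induction; the
  -- extra final term is multiplied by the default 0.
  shift : ∀ f n → (f ⊛ delay 0ℤ (suc k) g) (suc n) ≡ (f ⊛ delay 0ℤ k g) n
  shift f zero    = trans (cong (_⊕_ (f 0 * delay 0ℤ k g 0)) (ℤₚ.*-zeroʳ (f 1))) (ℤₚ.+-identityʳ _)
  shift f (suc n) = cong (_⊕_ (f 0 * delay 0ℤ k g (suc n))) (shift (f ∘ suc) n)

-- Cancellation of the factor 1 - q^(k+1).
delay-fixpoint-unique : ∀ k {f g h : Series} →
  (∀ n → f n ≡ h n ⊕ delay 0ℤ (suc k) f n) → (∀ n → g n ≡ h n ⊕ delay 0ℤ (suc k) g n) →
  ∀ n → f n ≡ g n
delay-fixpoint-unique k {f} {g} {h} f-rec g-rec n = below (suc n) n ≤-refl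
  where
  -- A shift by at least one place involves only earlier coefficients; `N` is the fuel of the strong
  -- induction.
  below : ∀ N n → n < N → f n ≡ g n
  below (suc N) zero    _           = trans (f-rec 0) (sym (g-rec 0))
  below (suc N) (suc n) (s≤s n<N) = trans (f-rec (suc n)) (trans
    (cong (_⊕_ (h (suc n))) (delay-cong k n (λ m m≤n → below N m (≤-trans (s≤s m≤n) n<N))))
    (sym (g-rec (suc n))))

-- Substitution of -q and recurrences for products

-- These are the coefficients of F(-q) when `f` gives those of F(q).
alternate : (ℕ → ℕ) → Series
alternate f n = -1ℤ ^ n * + f n

-- Substituting -q in q^k F(q) gives (-1)^k q^k F(-q).
alternate-delay : ∀ k f n → alternate (delay 0 k f) n ≡ -1ℤ ^ k * delay 0ℤ k (alternate f) n
alternate-delay zero    f n       = sym (ℤₚ.*-identityˡ _)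
alternate-delay (suc k) f zero    = sym (ℤₚ.*-zeroʳ (-1ℤ ^ suc k))
alternate-delay (suc k) f (suc n) =
  trans (ℤₚ.*-assoc -1ℤ (-1ℤ ^ n) _) (trans (cong (-1ℤ *_) (alternate-delay k f n))
    (sym (ℤₚ.*-assoc -1ℤ (-1ℤ ^ k) _)))

alternate-rec : ∀ k {f g h : ℕ → ℕ} → (∀ n → f n ≡ g n + delay 0 k h n) →
  ∀ n → alternate f n ≡ alternate g n ⊕ -1ℤ ^ k * delay 0ℤ k (alternate h) n
alternate-rec k {f} {g} {h} rec n = begin
  -1ℤ ^ n * + f n                          ≡⟨ cong (λ i → -1ℤ ^ n * + i) (rec n) ⟩
  -1ℤ ^ n * (+ g n ⊕ + delay 0 k h n)      ≡⟨ ℤₚ.*-distribˡ-+ (-1ℤ ^ n) (+ g n) _ ⟩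
  alternate g n ⊕ alternate (delay 0 k h) n ≡⟨ cong (_⊕_ (alternate g n)) (alternate-delay k h n) ⟩
  alternate g n ⊕ -1ℤ ^ k * delay 0ℤ k (alternate h) n ∎
  where open ≡-Reasoning

alternate-⊛-rec : ∀ k {f g h : ℕ → ℕ} → (∀ n → f n ≡ g n + delay 0 k h n) → ∀ s n →
  (alternate f ⊛ s) n ≡ (alternate g ⊛ s) n ⊕ -1ℤ ^ k * delay 0ℤ k (alternate h ⊛ s) n
alternate-⊛-rec k {f} {g} {h} rec s n =
  trans (⊛-cong n (λ m _ → alternate-rec k {f} {g} {h} rec m) (λ _ _ → refl))
    (trans (⊛-linearˡ (-1ℤ ^ k) (alternate g) (delay 0ℤ k (alternate h)) s n)
      (cong (λ i → (alternate g ⊛ s) n ⊕ -1ℤ ^ k * i) (⊛-delayˡ k (alternate h) s n)))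

series : (ℕ → ℕ) → Series
series f n = + f n

series-rec : ∀ k {f g h : ℕ → ℕ} → (∀ n → f n ≡ g n + delay 0 k h n) →
  ∀ n → series f n ≡ series g n ⊕ delay 0ℤ k (series h) n
series-rec k {f} {g} {h} rec n =
  trans (cong +_ (rec n)) (cong (_⊕_ (+ g n)) (delay-natural +_ k h n))

⊛-series-rec : ∀ k {f g h : ℕ → ℕ} → (∀ n → f n ≡ g n + delay 0 k h n) → ∀ s n →
  (s ⊛ series f) n ≡ (s ⊛ series g) n ⊕ delay 0ℤ k (s ⊛ series h) n
⊛-series-rec k {f} {g} {h} rec s n =
  trans (⊛-cong n (λ _ _ → refl) (λ m _ → series-rec k {f} {g} {h} rec m))
    (trans (⊛-distribˡ s (series g) (delay 0ℤ k (series h)) n)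
      (cong (_⊕_ ((s ⊛ series g) n)) (⊛-delayʳ k s (series h) n)))

-- The identity for bounded parts, and removal of the bound

convolution≤ : ∀ k n → (alternate (pod≤ k) ⊛ series (p̄ₒ≤ k)) n ≡ series (pod≤ k) n
convolution≤ zero n =
  trans (⊛-identityˡ (series (p̄ₒ≤ 0)) n
          -- With no parts allowed, the left factor is the series 1.
          (cong (λ i → 1ℤ * + i) (proj₁ pod≤0))
          (λ m → trans (cong (λ i → -1ℤ ^ suc m * + i) (proj₂ pod≤0 m)) (ℤₚ.*-zeroʳ (-1ℤ ^ suc m))))
        (cong +_ (agree n))
  where
  agree : ∀ n → p̄ₒ≤ 0 n ≡ pod≤ 0 n
  agree zero    = trans (proj₁ p̄ₒ≤0) (sym (proj₁ pod≤0))
  agree (suc n) = trans (proj₂ p̄ₒ≤0 n) (sym (proj₂ pod≤0 n))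
convolution≤ (suc k) with parity (suc k)
... | inj₁ (even , sign) =
  -- For even k + 1 the overpartition series is unchanged, the sign is +1, and both sides solve F =
  -- P + q^(k+1) F, with P the series of `pod≤ k`.
  delay-fixpoint-unique k {h = series (pod≤ k)} lhs (series-rec (suc k) (pod≤-even k even))
  where
  open ≡-Reasoning
  s = series (p̄ₒ≤ (suc k))
  lhs : ∀ n → (alternate (pod≤ (suc k)) ⊛ s) n ≡
              series (pod≤ k) n ⊕ delay 0ℤ (suc k) (alternate (pod≤ (suc k)) ⊛ s) n
  lhs n = begin
    (alternate (pod≤ (suc k)) ⊛ s) n
      ≡⟨ alternate-⊛-rec (suc k) (pod≤-even k even) s n ⟩
    (alternate (pod≤ k) ⊛ s) n ⊕ -1ℤ ^ suc k * d
      ≡⟨ cong₂ _⊕_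
           (trans (⊛-cong n (λ _ _ → refl) (λ m _ → cong +_ (p̄ₒ≤-even k even m))) (convolution≤ k n))
           (trans (cong (_* d) sign) (ℤₚ.*-identityˡ d)) ⟩
    series (pod≤ k) n ⊕ d ∎
    where d = delay 0ℤ (suc k) (alternate (pod≤ (suc k)) ⊛ s) n
-- For odd k + 1 the overlined copy supplies 1 + q^(k+1), exactly the new factor of the pod series;
-- the plain copies are absorbed by `times-a`.
... | inj₂ (odd , sign) = λ n → begin
  (alternate (pod≤ (suc k)) ⊛ series (p̄ₒ≤ (suc k))) n
    ≡⟨ ⊛-series-rec (suc k) (p̄ₒ≤-odd k odd) (alternate (pod≤ (suc k))) n ⟩
  (alternate (pod≤ (suc k)) ⊛ a) n ⊕ delay 0ℤ (suc k) (alternate (pod≤ (suc k)) ⊛ a) n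
    ≡⟨ cong₂ _⊕_ (times-a n) (delay-cong (suc k) n (λ m _ → times-a m)) ⟩
  series (pod≤ k) n ⊕ delay 0ℤ (suc k) (series (pod≤ k)) n
    ≡⟨ series-rec (suc k) (pod≤-odd k odd) n ⟨
  series (pod≤ (suc k)) n ∎
  where
  open ≡-Reasoning
  a = series (p̄ₒ-plain k)
  cancel : ∀ x d → (x ⊕ d) ⊕ -1ℤ * d ≡ x
  cancel = solve-∀
  -- The sign -1 turns the new pod factor into 1 - q^(k+1), which cancels the 1/(1 - q^(k+1)) of the
  -- plain copies.
  times-a : ∀ n → (alternate (pod≤ (suc k)) ⊛ a) n ≡ series (pod≤ k) n
  times-a n = begin
    (alternate (pod≤ (suc k)) ⊛ a) n
      ≡⟨ alternate-⊛-rec (suc k) (pod≤-odd k odd) a n ⟩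
    (alternate (pod≤ k) ⊛ a) n ⊕ -1ℤ ^ suc k * d
      ≡⟨ cong₂ _⊕_ (⊛-series-rec (suc k) (p̄ₒ-plain-odd k odd) (alternate (pod≤ k)) n)
                   (cong (_* d) sign) ⟩
    ((alternate (pod≤ k) ⊛ series (p̄ₒ≤ k)) n ⊕ d) ⊕ -1ℤ * d
      ≡⟨ cancel _ d ⟩
    (alternate (pod≤ k) ⊛ series (p̄ₒ≤ k)) n
      ≡⟨ convolution≤ k n ⟩
    series (pod≤ k) n ∎
    where d = delay 0ℤ (suc k) (alternate (pod≤ k) ⊛ a) n

-- Up to degree `n` no part exceeds `n`, so the bounded identity with `k = n` already gives
-- coefficient `n`.
convolution : ∀ n → (alternate pod ⊛ series (p̄ₒ ∘ +_)) n ≡ series pod n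
convolution n = begin
  (alternate pod ⊛ series (p̄ₒ ∘ +_)) n
    ≡⟨ ⊛-cong n (λ m m≤n → cong (λ i → -1ℤ ^ m * + i) (pod≤-all m≤n))
                (λ m m≤n → cong +_ (p̄ₒ≤-all m≤n)) ⟨
  (alternate (pod≤ n) ⊛ series (p̄ₒ≤ n)) n
    ≡⟨ convolution≤ n n ⟩
  series (pod≤ n) n
    ≡⟨ cong +_ (pod≤-all {n} {n} ≤-refl) ⟩
  series pod n ∎
  where open ≡-Reasoning

-- From the Cauchy product to the infinite series

sum-zero : ∀ f m → (∀ j → f j ≡ 0ℤ) → (∑[ j < m ] f (toℕ j)) ≡ 0ℤ
sum-zero f zero    f≡0 = refl
sum-zero f (suc m) f≡0 = cong₂ _⊕_ (f≡0 0) (sum-zero (f ∘ suc) m (f≡0 ∘ suc))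

sum-cong : ∀ {f g : ℕ → ℤ} m → (∀ j → f j ≡ g j) → (∑[ j < m ] f (toℕ j)) ≡ (∑[ j < m ] g (toℕ j))
sum-cong zero    f≡g = refl
sum-cong (suc m) f≡g = cong₂ _⊕_ (f≡g 0) (sum-cong m (f≡g ∘ suc))

-- Both sides are peeled at index 0 in step; when `n` reaches 0, every remaining summand has a
-- negative argument and vanishes by `g-neg`.
sum-convolution : ∀ (f : Series) (g : ℤ → ℤ) → (∀ m → g -[1+ m ] ≡ 0ℤ) → ∀ n m → n < m →
  (∑[ j < m ] (f (toℕ j) * g (+ n - + toℕ j))) ≡ (f ⊛ (g ∘ +_)) n
sum-convolution f g g-neg zero (suc m) (s≤s _) =
  trans (cong (_⊕_ (f 0 * g 0ℤ)) (sum-zero (λ j → f (suc j) * g -[1+ j ]) m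
          (λ j → trans (cong (f (suc j) *_) (g-neg j)) (ℤₚ.*-zeroʳ (f (suc j))))))
        (ℤₚ.+-identityʳ _)
sum-convolution f g g-neg (suc n) (suc m) (s≤s n<m) =
  cong₂ _⊕_ (cong (λ i → f 0 * g i) (ℤₚ.+-identityʳ (+ suc n)))
    (trans (sum-cong m (λ j → cong (λ i → f (suc j) * g i) (shift j)))
           (sum-convolution (f ∘ suc) g g-neg n m n<m))
  where
  shift : ∀ j → + suc n - + suc j ≡ + n - + j
  shift j = trans ([1+m]⊖[1+n]≡m⊖n n j) (sym (ℤₚ.[+m]-[+n]≡m⊖n n j))

theorem4p7 : (n : ℕ) → HasSum (λ j → -1ℤ ^ j * + pod j * + p̄ₒ (+ n - + j)) (+ pod n)
-- The partial sums are constant from `suc n` on, since the indices 0 to `n` make up `suc n` terms.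
theorem4p7 n = suc n , λ m n<m →
  trans (sum-convolution (alternate pod) (λ i → + p̄ₒ i) (λ _ → refl) n m n<m) (convolution n)
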